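{- There is a positive constant $C$ such that for all $n\ge 1$ we have $$|c_n|\le \frac{C}{n^{3/2}}.$$
   Context: Let $\mathcal H=L^2([0,1],dx)$ (complex-valued functions, Lebesgue measure) with its norm $\|\cdot\|$. The sequence $(c_n)_{n\ge 0}$ is defined recursively: $c_0=1$, and, writing $p_n(x)=c_0+c_1x+\ldots+c_nx^n$, for each $n\ge 0$ the number $c_{n+1}$ is the unique complex number $c$ for which the norm $\|p_n(x)+c\,x^{n+1}\|$ is minimal among all $c\in\mathbb C$. Equivalently, $c_0=1$ and $\frac{c_0}{n+1}+\frac{c_1}{n+2}+\ldots+\frac{c_n}{2n+1}=0$ for all $n\ge 1$. -}

module Defs where

open import Algebra.Apartness.Bundles using (HeytingField; HeytingCommutativeRing)
open import Algebra.Bundles using (CommutativeRing; Semiring)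
import Algebra.Apartness.Properties.HeytingCommutativeRing as HeytingProperties
import Algebra.Definitions.RawSemiring as RawSemiringDefinitions
import Algebra.Properties.Ring as RingProperties
open import Data.Fin.Base using (zero; suc; inject₁; fromℕ)
open import Data.Nat.Base as ℕ using (ℕ; zero; suc; NonZero)
open import Data.Product.Base using (∃-syntax; _×_; _,_; proj₁; proj₂)
open import Data.Sum.Base using (_⊎_; inj₁; inj₂)
open import Data.Vec.Functional using (Vector)
open import Level using (_⊔_) renaming (suc to lsuc)
open import Relation.Binary.Core using (Rel)
open import Relation.Binary.Structures using (IsStrictPartialOrder)
open import Relation.Nullary.Negation.Core using (¬_)

-- The real numbers, given axiomatically as a Cauchy complete Archimedean
-- ordered field.  Classically these axioms determine ℝ up to isomorphism.
-- Neither trichotomy nor decidability of the order is required, so that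
-- constructive Cauchy reals are a model as well.
record RealNumbers a ℓ₁ ℓ₂ : Set (lsuc (a ⊔ ℓ₁ ⊔ ℓ₂)) where
  infix 4 _<_ _≤_
  infix 9 √_

  field
    heytingField : HeytingField a ℓ₁ ℓ₂

  open HeytingField heytingField public renaming (zero to *-zero)

  open CommutativeRing (HeytingCommutativeRing.commutativeRing heytingCommutativeRing) public
    using (ring; semiring)

  open RawSemiringDefinitions (Semiring.rawSemiring semiring) public
    using (sum; _^_) renaming (_×_ to _×ₙ_)

  fromNat : ℕ → Carrier
  fromNat n = n ×ₙ 1#

  field
    _<_                  : Rel Carrier ℓ₂
    isStrictPartialOrder : IsStrictPartialOrder _≈_ _<_
    <⇒#                  : ∀ {x y} → x < y → x # y
    #⇒<⊎>                : ∀ {x y} → x # y → x < y ⊎ y < x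
    +-monoˡ-<            : ∀ {x y} z → x < y → x + z < y + z
    *-pos                : ∀ {x y} → 0# < x → 0# < y → 0# < x * y

  _≤_ : Rel Carrier ℓ₂
  x ≤ y = ¬ (y < x)

  -- Within ε x y  is  |x - y| < ε.
  Within : Carrier → Carrier → Carrier → Set ℓ₂
  Within ε x y = (x - y < ε) × (y - x < ε)

  field
    archimedean : ∀ x → ∃[ n ] x < fromNat n
    complete    : ∀ (s : ℕ → Carrier) →
                  (∀ ε → 0# < ε → ∃[ N ] (∀ m n → N ℕ.≤ m → N ℕ.≤ n → Within ε (s m) (s n))) →
                  ∃[ l ] (∀ ε → 0# < ε → ∃[ N ] (∀ n → N ℕ.≤ n → Within ε (s n) l))

    -- Existence of square roots already follows from completeness; the
    -- operation is total, with no constraint on its values at negative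
    -- arguments.
    √_       : Carrier → Carrier
    √-nonneg : ∀ {x} → 0# ≤ x → 0# ≤ √ x
    √-square : ∀ {x} → 0# ≤ x → √ x * √ x ≈ x

  open IsStrictPartialOrder isStrictPartialOrder public
    using (<-resp-≈; <-respʳ-≈; <-respˡ-≈)
    renaming (irrefl to <-irrefl; trans to <-trans; asym to <-asym)

  infixl 7 _/⟨_,_⟩

  _/⟨_,_⟩ : Carrier → (y : Carrier) → y # 0# → Carrier
  x /⟨ y , y#0 ⟩ = x * proj₁ (#⇒invertible y#0)

module GreedyCoefficients {a ℓ₁ ℓ₂} (ℝ : RealNumbers a ℓ₁ ℓ₂) where

  open RealNumbers ℝ public
  private
    open module HP = HeytingProperties heytingCommutativeRing
      using (1#0; x-0≈x; invertibleʳ⇒#)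
    open module RP = RingProperties ring
      using (-1*x≈-x; -‿involutive)

  0<1 : 0# < 1#
  0<1 with #⇒<⊎> 1#0
  ... | inj₂ 0<1 = 0<1
  ... | inj₁ 1<0 = <-respʳ-≈ (trans (-1*x≈-x (- 1#)) (-‿involutive 1#)) (*-pos 0<-1 0<-1)
    where
    0<-1 : 0# < - 1#
    0<-1 = <-respˡ-≈ (-‿inverseʳ 1#) (<-respʳ-≈ (+-identityˡ (- 1#)) (+-monoˡ-< (- 1#) 1<0))

  fromNat-pos : ∀ n → 0# < fromNat (suc n)
  fromNat-pos zero    = <-respʳ-≈ (sym (+-identityʳ 1#)) 0<1
  fromNat-pos (suc n) = <-trans (fromNat-pos n)
    (<-respˡ-≈ (+-identityˡ _) (+-monoˡ-< (fromNat (suc n)) 0<1))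

  ^-pos : ∀ {x} n → 0# < x → 0# < x ^ n
  ^-pos zero    0<x = 0<1
  ^-pos (suc n) 0<x = *-pos 0<x (^-pos n 0<x)

  √-#0 : ∀ {x} → 0# < x → √ x # 0#
  √-#0 {x} 0<x with #⇒invertible (#-sym (<⇒# 0<x))
  ... | x⁻¹ , _ , xx⁻¹≈1 = invertibleʳ⇒# (√ x * x⁻¹ ,
    trans (*-congʳ (x-0≈x (√ x)))
      (trans (sym (*-assoc (√ x) (√ x) x⁻¹))
        (trans (*-congʳ (trans (√-square (<-asym 0<x)) (sym (x-0≈x x)))) xx⁻¹≈1)))

  infix 10 _^3/2

  _^3/2 : ℕ → Carrier
  n ^3/2 = √ (fromNat n ^ 3)

  ^3/2-#0 : ∀ n → .{{_ : NonZero n}} → n ^3/2 # 0#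
  ^3/2-#0 (suc n) = √-#0 (^-pos 3 (fromNat-pos n))

  record ℂ : Set a where
    constructor _+i_
    field
      re im : Carrier

  open ℂ public

  infix  4 _≈ℂ_
  infixl 6 _+ℂ_
  infixl 7 _·_

  _≈ℂ_ : Rel ℂ ℓ₁
  z ≈ℂ w = (re z ≈ re w) × (im z ≈ im w)

  1ℂ : ℂ
  1ℂ = 1# +i 0#

  _+ℂ_ : ℂ → ℂ → ℂ
  z +ℂ w = (re z + re w) +i (im z + im w)

  _·_ : ℂ → Carrier → ℂ
  z · x = (re z * x) +i (im z * x)

  ∣_∣ : ℂ → Carrier
  ∣ z ∣ = √ (re z ^ 2 + im z ^ 2)

  record TaggedPartition (n : ℕ) : Set (a ⊔ ℓ₁ ⊔ ℓ₂) where
    field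
      point     : Vector Carrier (suc n)
      tag       : Vector Carrier n
      first     : point zero ≈ 0#
      last      : point (fromℕ n) ≈ 1#
      point≤tag : ∀ i → point (inject₁ i) ≤ tag i
      tag≤point : ∀ i → tag i ≤ point (suc i)

    width : Vector Carrier n
    width i = point (suc i) - point (inject₁ i)

  open TaggedPartition public using (width)

  riemannSum : ∀ {n} → (Carrier → Carrier) → TaggedPartition n → Carrier
  riemannSum f P = sum λ i → f (TaggedPartition.tag P i) * width P i

  -- I is the Riemann integral of f over [0,1].
  HasIntegral : (Carrier → Carrier) → Carrier → Set (a ⊔ ℓ₁ ⊔ ℓ₂)
  HasIntegral f I = ∀ ε → 0# < ε → ∃[ δ ] (0# < δ ×
    (∀ {n} (P : TaggedPartition n) → (∀ i → width P i < δ) → Within ε (riemannSum f P) I))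

  -- r is the L²([0,1]) norm of f.  Only polynomials are ever considered
  -- here, and for those the Riemann and Lebesgue integrals agree.
  HasNorm : (Carrier → ℂ) → Carrier → Set (a ⊔ ℓ₁ ⊔ ℓ₂)
  HasNorm f r = ∃[ I ] (HasIntegral (λ x → ∣ f x ∣ ^ 2) I × r ≈ √ I)

  partialSum : (ℕ → ℂ) → ℕ → Carrier → ℂ
  partialSum c zero    x = c 0 · x ^ 0
  partialSum c (suc n) x = partialSum c n x +ℂ c (suc n) · x ^ suc n

  extend : (ℕ → ℂ) → ℕ → ℂ → Carrier → ℂ
  extend c n d x = partialSum c n x +ℂ d · x ^ suc n

  record IsGreedy (c : ℕ → ℂ) : Set (a ⊔ ℓ₁ ⊔ ℓ₂) where
    field
      start   : c 0 ≈ℂ 1ℂ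
      minimal : ∀ n (d : ℂ) {r s} →
                HasNorm (extend c n (c (suc n))) r → HasNorm (extend c n d) s → r ≤ s

module Submission where

-- By minimality p n is orthogonal to x ^ n for every n ≥ 1.  Put q n = x p′ n
-- and E n = ‖ q n ‖².  Integrating by parts, orthogonality turns into
--   ⟨ q n , x ^ n ⟩ = p n (1),
--   ⟨ q n , x ^ n - x ^ (1+n) ⟩ = - (n+2) c (1+n) / (2n+3).
-- By Cauchy–Schwarz the second gives (1+n)³ c (1+n)² ≤ E n, because
-- ‖ x ^ n - x ^ (1+n) ‖² is of order n ^ -3, and the first gives
-- (2n+1) p n (1)² ≤ E n.  It remains to bound E.  The quantity
-- F n = E n - n p n (1)² is comparable to E n, and
--   F (1+n) ≤ F n + (n+1)(n+2) c (1+n)² / (2n+3) ≤ (1 + 1/(n+1)²) F n,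
-- so F is bounded because ∏ (1 + 1/n²) converges.  The conditions on c have
-- real coefficients, so its real and imaginary parts can be treated separately.

open import Algebra.Apartness.Bundles using (HeytingCommutativeRing)
import Algebra.Apartness.Properties.HeytingCommutativeRing as HeytingProperties
open import Algebra.Bundles using (CommutativeRing)
import Algebra.Properties.Ring as RingProperties
import Algebra.Properties.Semiring.Exp as SemiringExp
import Algebra.Properties.Semiring.Mult as SemiringMult
import Algebra.Properties.Semiring.Mult.TCOptimised as SemiringMult′
import Algebra.Solver.Ring as RingSolver
open import Algebra.Solver.Ring.AlmostCommutativeRing
  using (fromCommutativeRing; _-Raw-AlmostCommutative⟶_)
open import Data.Empty using (⊥-elim)
open import Data.Fin.Base using (zero; suc; inject₁; fromℕ)
open import Data.Integer.Base as ℤ using (ℤ; +_; -[1+_]; _⊖_; _◃_)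
import Data.Integer.Properties as ℤ
open import Data.Maybe.Base using (just; nothing)
open import Data.Nat.Base as ℕ using (ℕ; zero; suc; NonZero)
import Data.Nat.Properties as ℕ
open import Data.Product.Base using (∃-syntax; _×_; _,_; proj₁; proj₂)
import Data.Sign.Base as Sign
open import Data.Sum.Base using (_⊎_; inj₁; inj₂; [_,_]′)
open import Data.Vec.Functional using (Vector)
open import Function.Base using (_∘_)
open import Level using (_⊔_)
open import Relation.Binary.Definitions using (WeaklyDecidable)
import Relation.Binary.PropositionalEquality.Core as ≡
import Relation.Binary.Reasoning.Setoid as SetoidReasoning
open import Relation.Nullary.Decidable.Core using (yes; no)
open import Defs

-- Ring identities solved with integer coefficients.

module IntegerCoefficients {c ℓ} (R : CommutativeRing c ℓ) where

  open CommutativeRing R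
  open RingProperties ring
  open SemiringMult′ semiring using (×-homo-+; ×1-homo-*) renaming (_×_ to _×′_)
  open SetoidReasoning setoid

  -- Built on `_×′_`, for which `1 ×′ 1#` is `1#` itself rather than `1# + 0#`, so that the
  -- constants of the solver agree with those of the ring.
  fromℤ : ℤ → Carrier
  fromℤ (+ n)      = n ×′ 1#
  fromℤ (-[1+ n ]) = - (suc n ×′ 1#)

  private
    1+ : ∀ n → suc n ×′ 1# ≈ 1# + n ×′ 1#
    1+ n = ×-homo-+ 1# 1 n

    cancel : ∀ x y → (1# + x) - (1# + y) ≈ x - y
    cancel x y = begin
      (1# + x) - (1# + y)       ≈⟨ +-cong (+-comm 1# x) (sym (-‿+-comm 1# y)) ⟩
      (x + 1#) + (- 1# + - y)   ≈⟨ +-assoc x 1# _ ⟩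
      x + (1# + (- 1# + - y))   ≈⟨ +-congˡ (+-assoc 1# (- 1#) (- y)) ⟨
      x + ((1# - 1#) + - y)     ≈⟨ +-congˡ (+-congʳ (-‿inverseʳ 1#)) ⟩
      x + (0# + - y)            ≈⟨ +-congˡ (+-identityˡ (- y)) ⟩
      x - y                     ∎

  ⊖-homo : ∀ m n → fromℤ (m ⊖ n) ≈ m ×′ 1# - n ×′ 1#
  ⊖-homo zero    zero    = sym (-‿inverseʳ 0#)
  ⊖-homo (suc m) zero    = sym (trans (+-congˡ -0#≈0#) (+-identityʳ _))
  ⊖-homo zero    (suc n) = sym (+-identityˡ _)
  ⊖-homo (suc m) (suc n) = begin
    fromℤ (suc m ⊖ suc n)                ≡⟨ ≡.cong fromℤ (ℤ.[1+m]⊖[1+n]≡m⊖n m n) ⟩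
    fromℤ (m ⊖ n)                        ≈⟨ ⊖-homo m n ⟩
    m ×′ 1# - n ×′ 1#                    ≈⟨ cancel _ _ ⟨
    (1# + m ×′ 1#) - (1# + n ×′ 1#)      ≈⟨ +-cong (1+ m) (-‿cong (1+ n)) ⟨
    suc m ×′ 1# - suc n ×′ 1#            ∎

  +-homo : ∀ i j → fromℤ (i ℤ.+ j) ≈ fromℤ i + fromℤ j
  +-homo (+ m)      (+ n)      = ×-homo-+ 1# m n
  +-homo (+ m)      (-[1+ n ]) = ⊖-homo m (suc n)
  +-homo (-[1+ m ]) (+ n)      = trans (⊖-homo n (suc m)) (+-comm _ _)
  +-homo (-[1+ m ]) (-[1+ n ]) = begin
    - (suc (suc (m ℕ.+ n)) ×′ 1#)        ≡⟨ ≡.cong (λ k → - (k ×′ 1#)) (≡.sym (ℕ.+-suc (suc m) n)) ⟩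
    - ((suc m ℕ.+ suc n) ×′ 1#)          ≈⟨ -‿cong (×-homo-+ 1# (suc m) (suc n)) ⟩
    - (suc m ×′ 1# + suc n ×′ 1#)        ≈⟨ -‿+-comm _ _ ⟨
    - (suc m ×′ 1#) - suc n ×′ 1#        ∎

  -‿homo : ∀ i → fromℤ (ℤ.- i) ≈ - fromℤ i
  -‿homo (+ zero)   = sym -0#≈0#
  -‿homo (+ suc n)  = refl
  -‿homo (-[1+ n ]) = sym (-‿involutive _)

  private
    ◃⁺ : ∀ n → fromℤ (Sign.+ ◃ n) ≈ n ×′ 1#
    ◃⁺ zero    = refl
    ◃⁺ (suc n) = refl

    ◃⁻ : ∀ n → fromℤ (Sign.- ◃ n) ≈ - (n ×′ 1#)
    ◃⁻ zero    = sym -0#≈0#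
    ◃⁻ (suc n) = refl

  *-homo : ∀ i j → fromℤ (i ℤ.* j) ≈ fromℤ i * fromℤ j
  *-homo (+ m)      (+ n)      = trans (◃⁺ (m ℕ.* n)) (×1-homo-* m n)
  *-homo (+ m)      (-[1+ n ]) = trans (◃⁻ (m ℕ.* suc n))
    (trans (-‿cong (×1-homo-* m (suc n))) (-‿distribʳ-* _ _))
  *-homo (-[1+ m ]) (+ n)      = trans (◃⁻ (suc m ℕ.* n))
    (trans (-‿cong (×1-homo-* (suc m) n)) (-‿distribˡ-* _ _))
  *-homo (-[1+ m ]) (-[1+ n ]) = trans (◃⁺ (suc m ℕ.* suc n))
    (trans (×1-homo-* (suc m) (suc n)) (trans (sym (-‿involutive _))
      (trans (-‿cong (-‿distribʳ-* _ _)) (-‿distribˡ-* _ _))))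

  morphism : ℤ.+-*-rawRing -Raw-AlmostCommutative⟶ fromCommutativeRing R
  morphism = record
    { ⟦_⟧    = fromℤ
    ; +-homo = +-homo
    ; *-homo = *-homo
    ; -‿homo = -‿homo
    ; 0-homo = refl
    ; 1-homo = refl
    }

  -- Coefficients are compared as integers, because equality in `R` need not be decidable.
  coefficient≟ : WeaklyDecidable (λ i j → fromℤ i ≈ fromℤ j)
  coefficient≟ i j with i ℤ.≟ j
  ... | yes ≡.refl = just refl
  ... | no  _      = nothing

  open RingSolver ℤ.+-*-rawRing (fromCommutativeRing R) morphism coefficient≟ public
    using (Polynomial; con; _:+_; _:*_; _:-_; :-_; _:=_; solve)

  :0 :1 : ∀ {n} → Polynomial n
  :0 = con (+ 0)
  :1 = con (+ 1)

-- Order and square roots without trichotomy.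

module OrderedField {a ℓ₁ ℓ₂} (ℝ : RealNumbers a ℓ₁ ℓ₂) where

  open GreedyCoefficients ℝ public
  open HeytingProperties heytingCommutativeRing public
    using (x-0≈x; invertibleˡ⇒#; #-congʳ)
  open IntegerCoefficients (HeytingCommutativeRing.commutativeRing heytingCommutativeRing) public
    using (:0; :1; _:+_; _:*_; _:-_; :-_; _:=_; solve)

  -- The substitute for trichotomy: apartness is cotransitive, and apart elements are comparable.
  <-cotrans : ∀ {x y} z → x < y → x < z ⊎ z < y
  <-cotrans z x<y with #-cotrans (<⇒# x<y) z
  ... | inj₁ x#z with #⇒<⊎> x#z
  ...   | inj₁ x<z = inj₁ x<z
  ...   | inj₂ z<x = inj₂ (<-trans z<x x<y)
  <-cotrans z x<y | inj₂ z#y with #⇒<⊎> z#y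
  ...   | inj₁ z<y = inj₂ z<y
  ...   | inj₂ y<z = inj₁ (<-trans x<y y<z)

  ≤-refl : ∀ {x} → x ≤ x
  ≤-refl = <-irrefl refl

  ≤-reflexive : ∀ {x y} → x ≈ y → x ≤ y
  ≤-reflexive x≈y = <-irrefl (sym x≈y)

  ≤-trans : ∀ {x y z} → x ≤ y → y ≤ z → x ≤ z
  ≤-trans {y = y} x≤y y≤z z<x = [ y≤z , x≤y ]′ (<-cotrans y z<x)

  <⇒≤ : ∀ {x y} → x < y → x ≤ y
  <⇒≤ = <-asym

  ≤-<-trans : ∀ {x y z} → x ≤ y → y < z → x < z
  ≤-<-trans {x} x≤y y<z = [ (λ y<x → ⊥-elim (x≤y y<x)) , (λ x<z → x<z) ]′ (<-cotrans x y<z)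

  <-≤-trans : ∀ {x y z} → x < y → y ≤ z → x < z
  <-≤-trans {z = z} x<y y≤z = [ (λ x<z → x<z) , (λ z<y → ⊥-elim (y≤z z<y)) ]′ (<-cotrans z x<y)

  ≤-respˡ-≈ : ∀ {x y z} → x ≈ y → x ≤ z → y ≤ z
  ≤-respˡ-≈ x≈y x≤z z<y = x≤z (<-respʳ-≈ (sym x≈y) z<y)

  ≤-respʳ-≈ : ∀ {x y z} → x ≈ y → z ≤ x → z ≤ y
  ≤-respʳ-≈ x≈y z≤x y<z = z≤x (<-respˡ-≈ (sym x≈y) y<z)

  +-monoʳ-< : ∀ z {x y} → x < y → z + x < z + y
  +-monoʳ-< z x<y = <-respˡ-≈ (+-comm _ z) (<-respʳ-≈ (+-comm _ z) (+-monoˡ-< z x<y))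

  x<y⇒0<y-x : ∀ {x y} → x < y → 0# < y - x
  x<y⇒0<y-x {x} x<y = <-respˡ-≈ (-‿inverseʳ x) (+-monoˡ-< (- x) x<y)

  <-intro : ∀ {x y d} → 0# < d → x + d ≈ y → x < y
  <-intro {x} 0<d x+d≈y = <-respˡ-≈ (+-identityʳ x) (<-respʳ-≈ x+d≈y (+-monoʳ-< x 0<d))

  x≤y⇒0≤y-x : ∀ {x y} → x ≤ y → 0# ≤ y - x
  x≤y⇒0≤y-x {x} {y} x≤y y-x<0 = x≤y (<-respˡ-≈
    (solve 2 (λ x y → x :+ (y :- x) := y) refl x y) (<-respʳ-≈ (+-identityʳ x) (+-monoʳ-< x y-x<0)))

  ≤-intro : ∀ {x y d} → 0# ≤ d → x + d ≈ y → x ≤ y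
  ≤-intro {x} {y} {d} 0≤d x+d≈y y<x = 0≤d (<-intro (x<y⇒0<y-x y<x)
    (trans (+-congˡ (+-congˡ (-‿cong (sym x+d≈y))))
      (solve 2 (λ x d → d :+ (x :- (x :+ d)) := :0) refl x d)))

  +-nonneg : ∀ {x y} → 0# ≤ x → 0# ≤ y → 0# ≤ x + y
  +-nonneg {x} {y} 0≤x 0≤y = ≤-trans 0≤x (≤-intro 0≤y refl)

  +-pos : ∀ {x y} → 0# < x → 0# < y → 0# < x + y
  +-pos {x} 0<x 0<y = <-trans 0<x (<-intro 0<y refl)

  -‿pos : ∀ {x} → x < 0# → 0# < - x
  -‿pos {x} x<0 = <-respʳ-≈ (+-identityˡ (- x)) (x<y⇒0<y-x x<0)

  -- If `z` inverts the product, then `z * y` inverts `x`.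
  xy#0⇒x#0 : ∀ {x y} → x * y # 0# → x # 0#
  xy#0⇒x#0 {x} {y} xy#0 with #⇒invertible xy#0
  ... | z , zxy≈1 , _ = invertibleˡ⇒# (z * y , trans
    (solve 3 (λ x y z → z :* y :* (x :- :0) := z :* (x :* y :- :0)) refl x y z) zxy≈1)

  neg*neg-pos : ∀ {x y} → x < 0# → y < 0# → 0# < x * y
  neg*neg-pos {x} {y} x<0 y<0 = <-respʳ-≈
    (solve 2 (λ x y → :- x :* :- y := x :* y) refl x y) (*-pos (-‿pos x<0) (-‿pos y<0))

  xy<0⇒x≶0 : ∀ {x y} → x * y < 0# → x < 0# ⊎ 0# < x
  xy<0⇒x≶0 xy<0 = #⇒<⊎> (xy#0⇒x#0 (<⇒# xy<0))

  -- A negative product would make both factors apart from zero, hence comparable with it, and every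
  -- combination of signs is excluded.
  *-nonneg : ∀ {x y} → 0# ≤ x → 0# ≤ y → 0# ≤ x * y
  *-nonneg {x} {y} 0≤x 0≤y xy<0 =
    [ 0≤x , (λ 0<x → [ 0≤y , (λ 0<y → <-asym xy<0 (*-pos 0<x 0<y)) ]′
                       (xy<0⇒x≶0 (<-respˡ-≈ (*-comm x y) xy<0))) ]′ (xy<0⇒x≶0 xy<0)

  sq-nonneg : ∀ x → 0# ≤ x * x
  sq-nonneg x x²<0 =
    [ (λ x<0 → <-asym x²<0 (neg*neg-pos x<0 x<0)) , (λ 0<x → <-asym x²<0 (*-pos 0<x 0<x)) ]′
    (xy<0⇒x≶0 x²<0)

  *-cancelˡ-nonneg : ∀ {x y} → 0# < x → 0# ≤ x * y → 0# ≤ y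
  *-cancelˡ-nonneg {x} {y} 0<x 0≤xy y<0 = 0≤xy (<-intro (*-pos 0<x (-‿pos y<0))
    (solve 2 (λ x y → x :* y :+ x :* :- y := :0) refl x y))

  *-cancelˡ-≤ : ∀ {w x y} → 0# < w → w * x ≤ w * y → x ≤ y
  *-cancelˡ-≤ {w} {x} {y} 0<w wx≤wy = ≤-intro
    (*-cancelˡ-nonneg 0<w (≤-respʳ-≈
      (solve 3 (λ w x y → w :* y :- w :* x := w :* (y :- x)) refl w x y) (x≤y⇒0≤y-x wx≤wy)))
    (solve 2 (λ x y → x :+ (y :- x) := y) refl x y)

  *-monoʳ-≤ : ∀ {w x y} → 0# ≤ w → x ≤ y → w * x ≤ w * y
  *-monoʳ-≤ {w} {x} {y} 0≤w x≤y = ≤-intro (*-nonneg 0≤w (x≤y⇒0≤y-x x≤y))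
    (solve 3 (λ w x y → w :* x :+ w :* (y :- x) := w :* y) refl w x y)

  *-cancelˡ-pos : ∀ {x y} → 0# < x → 0# < x * y → 0# < y
  *-cancelˡ-pos {x} {y} 0<x 0<xy =
    [ (λ y<0 → ⊥-elim (<-asym 0<xy (<-intro (*-pos 0<x (-‿pos y<0))
        (solve 2 (λ x y → x :* y :+ x :* :- y := :0) refl x y)))) , (λ 0<y → 0<y) ]′
    (#⇒<⊎> (xy#0⇒x#0 (#-congʳ (*-comm x y) (#-sym (<⇒# 0<xy)))))

  -- Apartness is tight, so it suffices to refute `x # 0#`, which would make the square positive.
  sq≤0⇒≈0 : ∀ {x} → x * x ≤ 0# → x ≈ 0#
  sq≤0⇒≈0 {x} x²≤0 = proj₁ (tight x 0#) λ x#0 →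
    [ (λ x<0 → x²≤0 (neg*neg-pos x<0 x<0)) , (λ 0<x → x²≤0 (*-pos 0<x 0<x)) ]′ (#⇒<⊎> x#0)

  sq-cancel-≤ : ∀ {x y} → 0# ≤ y → x * x ≤ y * y → x ≤ y
  sq-cancel-≤ {x} {y} 0≤y x²≤y² y<x = x²≤y² (<-intro (*-pos 0<x-y 0<x-y+2y)
    (solve 2 (λ x y → y :* y :+ (x :- y) :* ((x :- y) :+ (y :+ y)) := x :* x) refl x y))
    where
    0<x-y = x<y⇒0<y-x y<x
    0<x-y+2y = <-≤-trans 0<x-y (≤-intro (+-nonneg 0≤y 0≤y) refl)

  2# 3# 4# 9# : Carrier
  2# = 1# + 1#
  3# = 1# + 2#
  4# = 2# * 2#
  9# = 3# * 3#

  0<2 : 0# < 2#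
  0<2 = +-pos 0<1 0<1

  0<3 : 0# < 3#
  0<3 = +-pos 0<1 0<2

  -- Feeds a hypothesis `u ≈ v` to the ring solver: with a suitable multiplier `k`, the remaining
  -- equation is a pure ring identity.
  combine : ∀ {x y k u v} → u ≈ v → x + k * u ≈ y + k * v → x ≈ y
  combine {x} {y} {k} {u} {v} u≈v eq = begin
    x                   ≈⟨ solve 3 (λ x k u → x := x :+ k :* u :- k :* u) refl x k u ⟩
    x + k * u - k * u   ≈⟨ +-cong eq (-‿cong (*-congˡ u≈v)) ⟩
    y + k * v - k * v   ≈⟨ solve 3 (λ x k u → x := x :+ k :* u :- k :* u) refl y k v ⟨
    y                   ∎
    where open SetoidReasoning setoid

  √-cancel-≤ : ∀ {x y} → 0# ≤ x → 0# ≤ y → √ x ≤ √ y → x ≤ y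
  √-cancel-≤ {x} {y} 0≤x 0≤y √x≤√y = ≤-respˡ-≈ (√-square 0≤x) (≤-respʳ-≈ (√-square 0≤y)
    (≤-trans (*-monoʳ-≤ (√-nonneg 0≤x) √x≤√y)
      (≤-respˡ-≈ (*-comm _ _) (*-monoʳ-≤ (√-nonneg 0≤y) √x≤√y))))

  √-pos : ∀ {x} → 0# < x → 0# < √ x
  √-pos 0<x = [ (λ √x<0 → ⊥-elim (√-nonneg (<⇒≤ 0<x) √x<0)) , (λ 0<√x → 0<√x) ]′ (#⇒<⊎> (√-#0 0<x))

-- Powers and integration on [0,1].

module Integration {a ℓ₁ ℓ₂} (ℝ : RealNumbers a ℓ₁ ℓ₂) where

  open OrderedField ℝ public
  open SemiringMult semiring using (×-homo-+)
  open SemiringExp semiring using (^-homo-*; ^-congˡ)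

  fromNat-+ : ∀ m n → fromNat (m ℕ.+ n) ≈ fromNat m + fromNat n
  fromNat-+ = ×-homo-+ 1#

  fromNat-nonneg : ∀ n → 0# ≤ fromNat n
  fromNat-nonneg zero    = ≤-refl
  fromNat-nonneg (suc n) = <⇒≤ (fromNat-pos n)

  fromNat-mono : ∀ {m n} → m ℕ.≤ n → fromNat m ≤ fromNat n
  fromNat-mono {n = n} ℕ.z≤n = fromNat-nonneg n
  fromNat-mono (ℕ.s≤s m≤n) = ≤-intro (x≤y⇒0≤y-x (fromNat-mono m≤n))
    (solve 2 (λ x y → :1 :+ x :+ (y :- x) := :1 :+ y) refl _ _)

  reciprocal : ∀ {x} → 0# < x → ∃[ y ] x * y ≈ 1#
  reciprocal {x} 0<x with #⇒invertible (#-sym (<⇒# 0<x))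
  ... | y , _ , xy≈1 = y , trans (*-congʳ (sym (x-0≈x x))) xy≈1

  reciprocal-pos : ∀ {x y} → 0# < x → x * y ≈ 1# → 0# < y
  reciprocal-pos 0<x xy≈1 = *-cancelˡ-pos 0<x (<-respʳ-≈ (sym xy≈1) 0<1)

  abstract
    1/1+_ : ℕ → Carrier
    1/1+ n = proj₁ (reciprocal (fromNat-pos n))

    1/1+-inverse : ∀ n → fromNat (suc n) * 1/1+ n ≈ 1#
    1/1+-inverse n = proj₂ (reciprocal (fromNat-pos n))

  1/1+-pos : ∀ n → 0# < 1/1+ n
  1/1+-pos n = reciprocal-pos (fromNat-pos n) (1/1+-inverse n)

  1^n≈1 : ∀ n → 1# ^ n ≈ 1#
  1^n≈1 zero    = refl
  1^n≈1 (suc n) = trans (*-identityˡ _) (1^n≈1 n)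

  ^-nonneg : ∀ {x} n → 0# ≤ x → 0# ≤ x ^ n
  ^-nonneg zero    0≤x = <⇒≤ 0<1
  ^-nonneg (suc n) 0≤x = *-nonneg 0≤x (^-nonneg n 0≤x)

  ^-mono : ∀ {x y} n → 0# ≤ x → x ≤ y → x ^ n ≤ y ^ n
  ^-mono zero    0≤x x≤y = ≤-refl
  ^-mono {x} {y} (suc n) 0≤x x≤y = ≤-intro
    (+-nonneg (*-nonneg 0≤x (x≤y⇒0≤y-x (^-mono n 0≤x x≤y)))
              (*-nonneg (x≤y⇒0≤y-x x≤y) (^-nonneg n (≤-trans 0≤x x≤y))))
    (solve 4 (λ x y p q → x :* p :+ (x :* (q :- p) :+ (y :- x) :* q) := y :* q) refl x y (x ^ n) (y ^ n))

  ^-≤1 : ∀ {x} n → 0# ≤ x → x ≤ 1# → x ^ n ≤ 1#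
  ^-≤1 n 0≤x x≤1 = ≤-respʳ-≈ (1^n≈1 n) (^-mono n 0≤x x≤1)

  -- Mean value estimate with the derivative taken at the right endpoint; `^-lower` takes it at the
  -- left one. Divided by 1+n, the two enclose the integral of t^n over [x, y].
  ^-upper : ∀ {x y} n → 0# ≤ x → x ≤ y →
            y ^ suc n ≤ x ^ suc n + fromNat (suc n) * (y ^ n * (y - x))
  ^-upper {x} {y} zero 0≤x x≤y = ≤-reflexive
    (solve 2 (λ x y → y :* :1 := x :* :1 :+ (:1 :+ :0) :* (:1 :* (y :- x))) refl x y)
  ^-upper {x} {y} (suc n) 0≤x x≤y = ≤-intro
    (+-nonneg (*-nonneg 0≤x (x≤y⇒0≤y-x (^-upper n 0≤x x≤y)))
      (*-nonneg 0≤y-x (*-nonneg (fromNat-nonneg (suc n)) (*-nonneg (^-nonneg n (≤-trans 0≤x x≤y)) 0≤y-x))))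
    (solve 5 (λ x y p q c → y :* (y :* q) :+ (x :* (x :* p :+ c :* (q :* (y :- x)) :- y :* q)
                              :+ (y :- x) :* (c :* (q :* (y :- x))))
                            := x :* (x :* p) :+ (:1 :+ c) :* (y :* q :* (y :- x)))
      refl x y (x ^ n) (y ^ n) (fromNat (suc n)))
    where 0≤y-x = x≤y⇒0≤y-x x≤y

  ^-lower : ∀ {x y} n → 0# ≤ x → x ≤ y →
            x ^ suc n + fromNat (suc n) * (x ^ n * (y - x)) ≤ y ^ suc n
  ^-lower {x} {y} zero 0≤x x≤y = ≤-reflexive
    (solve 2 (λ x y → x :* :1 :+ (:1 :+ :0) :* (:1 :* (y :- x)) := y :* :1) refl x y)
  ^-lower {x} {y} (suc n) 0≤x x≤y = ≤-intro
    (+-nonneg (*-nonneg (≤-trans 0≤x x≤y) (x≤y⇒0≤y-x (^-lower n 0≤x x≤y)))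
      (*-nonneg 0≤y-x (*-nonneg (fromNat-nonneg (suc n)) (*-nonneg (^-nonneg n 0≤x) 0≤y-x))))
    (solve 5 (λ x y p q c → x :* (x :* p) :+ (:1 :+ c) :* (x :* p :* (y :- x))
                            :+ (y :* (y :* q :- (x :* p :+ c :* (p :* (y :- x))))
                              :+ (y :- x) :* (c :* (p :* (y :- x))))
                            := y :* (y :* q))
      refl x y (x ^ n) (y ^ n) (fromNat (suc n)))
    where 0≤y-x = x≤y⇒0≤y-x x≤y

  ^-lipschitz : ∀ {x y} n → 0# ≤ x → x ≤ y → y ≤ 1# → y ^ n - x ^ n ≤ fromNat n * (y - x)
  ^-lipschitz {x} {y} zero 0≤x x≤y y≤1 = ≤-reflexive
    (solve 2 (λ x y → :1 :- :1 := :0 :* (y :- x)) refl x y)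
  ^-lipschitz {x} {y} (suc n) 0≤x x≤y y≤1 = ≤-intro
    (+-nonneg (x≤y⇒0≤y-x (^-upper n 0≤x x≤y))
      (*-nonneg (fromNat-nonneg (suc n))
        (*-nonneg (x≤y⇒0≤y-x (^-≤1 n (≤-trans 0≤x x≤y) y≤1)) (x≤y⇒0≤y-x x≤y))))
    (solve 5 (λ w p q r c → p :- q :+ ((q :+ c :* (r :* w)) :- p :+ c :* ((:1 :- r) :* w)) := c :* w)
      refl (y - x) (y ^ suc n) (x ^ suc n) (y ^ n) (fromNat (suc n)))

  -- Encodes |e| ≤ b by two one-sided inequalities.
  Bounded : Carrier → Carrier → Set ℓ₂
  Bounded b e = (0# ≤ b + e) × (0# ≤ b - e)

  Bounded-cong : ∀ {b b′ e e′} → b ≈ b′ → e ≈ e′ → Bounded b e → Bounded b′ e′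
  Bounded-cong b≈b′ e≈e′ (l , u) =
    ≤-respʳ-≈ (+-cong b≈b′ e≈e′) l , ≤-respʳ-≈ (+-cong b≈b′ (-‿cong e≈e′)) u

  Bounded-+ : ∀ {b b′ e e′} → Bounded b e → Bounded b′ e′ → Bounded (b + b′) (e + e′)
  Bounded-+ {b} {b′} {e} {e′} (l , u) (l′ , u′) =
    ≤-respʳ-≈ (solve 4 (λ b b′ e e′ → (b :+ e) :+ (b′ :+ e′) := (b :+ b′) :+ (e :+ e′)) refl b b′ e e′)
      (+-nonneg l l′) ,
    ≤-respʳ-≈ (solve 4 (λ b b′ e e′ → (b :- e) :+ (b′ :- e′) := (b :+ b′) :- (e :+ e′)) refl b b′ e e′)
      (+-nonneg u u′)

  Bounded-≤ : ∀ {b b′ e} → b ≤ b′ → Bounded b e → Bounded b′ e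
  Bounded-≤ {b} {b′} {e} b≤b′ be =
    Bounded-cong (solve 2 (λ b b′ → b :+ (b′ :- b) := b′) refl b b′) (+-identityʳ e)
      (Bounded-+ be (≤-respʳ-≈ (sym (+-identityʳ _)) 0≤b′-b , ≤-respʳ-≈ (sym (x-0≈x _)) 0≤b′-b))
    where 0≤b′-b = x≤y⇒0≤y-x b≤b′

  1+x² 1+x+x² : Carrier → Carrier
  1+x² x   = 1# + x * x
  1+x+x² x = 1# + x + x * x

  1+x²-nonneg : ∀ x → 0# ≤ 1+x² x
  1+x²-nonneg x = +-nonneg (<⇒≤ 0<1) (sq-nonneg x)

  1+x+x²-nonneg : ∀ x → 0# ≤ 1+x+x² x
  1+x+x²-nonneg x = *-cancelˡ-nonneg (+-pos 0<1 0<1)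
    (≤-respʳ-≈ (solve 1 (λ x → (:1 :+ x :* x) :+ (:1 :+ x) :* (:1 :+ x)
                             := (:1 :+ :1) :* (:1 :+ x :+ x :* x)) refl x)
      (+-nonneg (1+x²-nonneg x) (sq-nonneg (1# + x))))

  -- An explicit stand-in for 1 + |c|, absolute values not being available.
  magnitude : Carrier → Carrier
  magnitude c = 1+x+x² c + 1+x² c

  magnitude-nonneg : ∀ c → 0# ≤ magnitude c
  magnitude-nonneg c = +-nonneg (1+x+x²-nonneg c) (1+x²-nonneg c)

  -- The sign of `c` cannot be decided, so `c` is split as 1+c+c² minus 1+c², both nonnegative, and
  -- the two one-sided bounds are scaled separately.
  Bounded-* : ∀ {b e} c → Bounded b e → Bounded (magnitude c * b) (c * e)
  Bounded-* {b} {e} c (l , u) =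
    ≤-respʳ-≈ (solve 3 (λ b e c → (:1 :+ c :+ c :* c) :* (b :+ e) :+ (:1 :+ c :* c) :* (b :- e)
                := ((:1 :+ c :+ c :* c) :+ (:1 :+ c :* c)) :* b :+ c :* e) refl b e c)
      (+-nonneg (*-nonneg (1+x+x²-nonneg c) l) (*-nonneg (1+x²-nonneg c) u)) ,
    ≤-respʳ-≈ (solve 3 (λ b e c → (:1 :+ c :* c) :* (b :+ e) :+ (:1 :+ c :+ c :* c) :* (b :- e)
                := ((:1 :+ c :+ c :* c) :+ (:1 :+ c :* c)) :* b :- c :* e) refl b e c)
      (+-nonneg (*-nonneg (1+x²-nonneg c) l) (*-nonneg (1+x+x²-nonneg c) u))

  error : (F f : Carrier → Carrier) (x t y : Carrier) → Carrier
  error F f x t y = F y - F x - f t * (y - x)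

  -- Uniform differentiability with quadratic error on [0,1]; unlike
  -- integrability it is visibly closed under linear combinations.
  record Primitive (f : Carrier → Carrier) (I : Carrier) : Set (a ⊔ ℓ₁ ⊔ ℓ₂) where
    field
      F        : Carrier → Carrier
      F-cong   : ∀ {x y} → x ≈ y → F x ≈ F y
      total    : F 1# - F 0# ≈ I
      K        : Carrier
      K-nonneg : 0# ≤ K
      bound    : ∀ {x t y} → 0# ≤ x → x ≤ t → t ≤ y → y ≤ 1# →
                 Bounded (K * ((y - x) * (y - x))) (error F f x t y)

  Primitive-cong : ∀ {f g I J} → (∀ x → f x ≈ g x) → I ≈ J → Primitive f I → Primitive g J
  Primitive-cong f≈g I≈J P = record
    { F = F ; F-cong = F-cong ; total = trans total I≈J ; K = K ; K-nonneg = K-nonneg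
    ; bound = λ 0≤x x≤t t≤y y≤1 →
        Bounded-cong refl (+-congˡ (-‿cong (*-congʳ (f≈g _)))) (bound 0≤x x≤t t≤y y≤1)
    } where open Primitive P

  Primitive-+ : ∀ {f g I J} → Primitive f I → Primitive g J → Primitive (λ x → f x + g x) (I + J)
  Primitive-+ {f} {g} P Q = record
    { F        = λ x → P.F x + Q.F x
    ; F-cong   = λ x≈y → +-cong (P.F-cong x≈y) (Q.F-cong x≈y)
    ; total    = trans (solve 4 (λ p q r s → (p :+ q) :- (r :+ s) := (p :- r) :+ (q :- s)) refl _ _ _ _)
                   (+-cong P.total Q.total)
    ; K        = P.K + Q.K
    ; K-nonneg = +-nonneg P.K-nonneg Q.K-nonneg
    ; bound    = λ {x} {t} {y} 0≤x x≤t t≤y y≤1 → Bounded-cong (sym (distribʳ _ _ _))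
        (solve 7 (λ p q p′ q′ s t w → ((p :- p′) :- s :* w) :+ ((q :- q′) :- t :* w)
                    := ((p :+ q) :- (p′ :+ q′)) :- (s :+ t) :* w)
          refl (P.F y) (Q.F y) (P.F x) (Q.F x) (f t) (g t) (y - x))
        (Bounded-+ (P.bound 0≤x x≤t t≤y y≤1) (Q.bound 0≤x x≤t t≤y y≤1))
    }
    where
    module P = Primitive P
    module Q = Primitive Q

  Primitive-* : ∀ {f I} c → Primitive f I → Primitive (λ x → c * f x) (c * I)
  Primitive-* {f} c P = record
    { F        = λ x → c * F x
    ; F-cong   = λ x≈y → *-congˡ (F-cong x≈y)
    ; total    = trans (solve 3 (λ c p q → c :* p :- c :* q := c :* (p :- q)) refl _ _ _) (*-congˡ total)
    ; K        = magnitude c * K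
    ; K-nonneg = *-nonneg (magnitude-nonneg c) K-nonneg
    ; bound    = λ {x} {t} {y} 0≤x x≤t t≤y y≤1 → Bounded-cong (sym (*-assoc _ _ _))
        (solve 5 (λ c p p′ s w → c :* ((p :- p′) :- s :* w) := (c :* p :- c :* p′) :- (c :* s) :* w)
          refl c (F y) (F x) (f t) (y - x))
        (Bounded-* c (bound 0≤x x≤t t≤y y≤1))
    }
    where open Primitive P

  -- The increment of x^(1+n)/(1+n) over [x, y] lies, like t^n (y-x), between x^n (y-x) and y^n
  -- (y-x). These differ by at most n (y-x)², whence the choice of `K`.
  Primitive-^ : ∀ n → Primitive (_^ n) (1/1+ n)
  Primitive-^ n = record
    { F        = λ x → r * x ^ suc n
    ; F-cong   = λ x≈y → *-congˡ (^-congˡ (suc n) x≈y)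
    ; total    = trans (+-cong (*-congˡ (1^n≈1 (suc n))) refl)
                   (solve 2 (λ r z → r :* :1 :- r :* (:0 :* z) := r) refl r (0# ^ n))
    ; K        = fromNat n
    ; K-nonneg = fromNat-nonneg n
    ; bound    = bound
    }
    where
    r = 1/1+ n
    0≤r = <⇒≤ (1/1+-pos n)

    scaled-≤ : ∀ {p q w} → p ≤ q + fromNat (suc n) * w → r * p ≤ r * q + w
    scaled-≤ {p} {q} {w} p≤ = ≤-respʳ-≈
      (trans (solve 4 (λ r q c w → r :* (q :+ c :* w) := r :* q :+ c :* r :* w) refl r q (fromNat (suc n)) w)
        (+-congˡ (trans (*-congʳ (1/1+-inverse n)) (*-identityˡ w))))
      (*-monoʳ-≤ 0≤r p≤)

    scaled-≥ : ∀ {p q w} → q + fromNat (suc n) * w ≤ p → r * q + w ≤ r * p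
    scaled-≥ {p} {q} {w} ≤p = ≤-respˡ-≈
      (trans (solve 4 (λ r q c w → r :* (q :+ c :* w) := r :* q :+ c :* r :* w) refl r q (fromNat (suc n)) w)
        (+-congˡ (trans (*-congʳ (1/1+-inverse n)) (*-identityˡ w))))
      (*-monoʳ-≤ 0≤r ≤p)

    bound : ∀ {x t y} → 0# ≤ x → x ≤ t → t ≤ y → y ≤ 1# →
            Bounded (fromNat n * ((y - x) * (y - x))) (error (λ x → r * x ^ suc n) (_^ n) x t y)
    bound {x} {t} {y} 0≤x x≤t t≤y y≤1 =
      ≤-respʳ-≈ (solve 8 (λ c w p q r yn tn xn →
          (p :- (q :+ xn :* w)) :+ (yn :- tn) :* w :+ (c :* w :- (yn :- xn)) :* w
            := c :* (w :* w) :+ ((p :- q) :- tn :* w))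
          refl (fromNat n) (y - x) (r * y ^ suc n) (r * x ^ suc n) r (y ^ n) (t ^ n) (x ^ n))
        (+-nonneg (+-nonneg (x≤y⇒0≤y-x (scaled-≥ (^-lower n 0≤x x≤y)))
            (*-nonneg (x≤y⇒0≤y-x (^-mono n (≤-trans 0≤x x≤t) t≤y)) 0≤y-x))
          (*-nonneg (x≤y⇒0≤y-x (^-lipschitz n 0≤x x≤y y≤1)) 0≤y-x)) ,
      ≤-respʳ-≈ (solve 8 (λ c w p q r yn tn xn →
          ((q :+ yn :* w) :- p) :+ (tn :- xn) :* w :+ (c :* w :- (yn :- xn)) :* w
            := c :* (w :* w) :- ((p :- q) :- tn :* w))
          refl (fromNat n) (y - x) (r * y ^ suc n) (r * x ^ suc n) r (y ^ n) (t ^ n) (x ^ n))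
        (+-nonneg (+-nonneg (x≤y⇒0≤y-x (scaled-≤ (^-upper n 0≤x x≤y)))
            (*-nonneg (x≤y⇒0≤y-x (^-mono n 0≤x x≤t)) 0≤y-x))
          (*-nonneg (x≤y⇒0≤y-x (^-lipschitz n 0≤x x≤y y≤1)) 0≤y-x))
      where
      x≤y = ≤-trans x≤t t≤y
      0≤y-x = x≤y⇒0≤y-x x≤y

  -- Convergence of Riemann sums.

  first≤last : ∀ {n} (p : Vector Carrier (suc n)) → (∀ i → p (inject₁ i) ≤ p (suc i)) → p zero ≤ p (fromℕ n)
  first≤last {zero}  p p↗ = ≤-refl
  first≤last {suc n} p p↗ = ≤-trans (p↗ zero) (first≤last (p ∘ suc) (p↗ ∘ suc))

  module _ {f I} (P : Primitive f I) where

    open Primitive P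

    -- Increments of `F` telescope, so the errors of the cells add up. A cell of width w < δ
    -- contributes at most K w² ≤ K δ w, and the widths sum to the total length.
    riemann-error : ∀ {n δ} (p : Vector Carrier (suc n)) (t : Vector Carrier n) →
      (∀ i → p (inject₁ i) ≤ t i) → (∀ i → t i ≤ p (suc i)) →
      0# ≤ p zero → p (fromℕ n) ≤ 1# → (∀ i → p (suc i) - p (inject₁ i) < δ) →
      Bounded (K * δ * (p (fromℕ n) - p zero))
        (F (p (fromℕ n)) - F (p zero) - sum λ i → f (t i) * (p (suc i) - p (inject₁ i)))
    riemann-error {zero} {δ} p t _ _ _ _ _ =
      ≤-reflexive (solve 3 (λ k x y → :0 := k :* (x :- x) :+ ((y :- y) :- :0)) refl (K * δ) (p zero) (F (p zero))) ,
      ≤-reflexive (solve 3 (λ k x y → :0 := k :* (x :- x) :- ((y :- y) :- :0)) refl (K * δ) (p zero) (F (p zero)))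
    riemann-error {suc n} {δ} p t p≤t t≤p 0≤p p≤1 w<δ = Bounded-cong
      (solve 4 (λ k x y z → k :* (y :- x) :+ k :* (z :- y) := k :* (z :- x))
        refl (K * δ) (p zero) (p (suc zero)) (p (fromℕ (suc n))))
      (solve 5 (λ x y z u s → (y :- x :- u) :+ (z :- y :- s) := z :- x :- (u :+ s))
        refl (F (p zero)) (F (p (suc zero))) (F (p (fromℕ (suc n)))) _ _)
      (Bounded-+
        (Bounded-≤ w²≤δw (bound 0≤p (p≤t zero) (t≤p zero) (≤-trans p₁≤p p≤1)))
        (riemann-error (p ∘ suc) (t ∘ suc) (p≤t ∘ suc) (t≤p ∘ suc)
          (≤-trans 0≤p p₀≤p₁) p≤1 (w<δ ∘ suc)))
      where
      p₀≤p₁ = ≤-trans (p≤t zero) (t≤p zero)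
      p₁≤p : p (suc zero) ≤ p (fromℕ (suc n))
      p₁≤p = first≤last (p ∘ suc) λ i → ≤-trans (p≤t (suc i)) (t≤p (suc i))
      w = p (suc zero) - p zero
      w²≤δw : K * (w * w) ≤ K * δ * w
      w²≤δw = ≤-intro
        (*-nonneg K-nonneg (*-nonneg (x≤y⇒0≤y-x p₀≤p₁) (x≤y⇒0≤y-x (<⇒≤ (w<δ zero)))))
        (solve 3 (λ k w d → k :* (w :* w) :+ k :* (w :* (d :- w)) := k :* d :* w) refl K w δ)

    Primitive⇒HasIntegral : HasIntegral f I
    Primitive⇒HasIntegral ε 0<ε with reciprocal {K + 1#} (≤-<-trans K-nonneg (<-intro 0<1 refl))
    ... | y , [K+1]y≈1 = δ , *-pos 0<ε 0<y , within
      where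
      -- Here `y` is 1/(K+1); the added 1 keeps the divisor positive when K = 0 and makes K δ < ε
      -- strict.
      δ = ε * y
      0<y = reciprocal-pos (≤-<-trans K-nonneg (<-intro 0<1 refl)) [K+1]y≈1

      Kδ<ε : K * δ < ε
      Kδ<ε = <-intro (*-pos 0<ε 0<y) (trans
        (solve 3 (λ k e y → k :* (e :* y) :+ e :* y := e :* ((k :+ :1) :* y)) refl K ε y)
        (trans (*-congˡ [K+1]y≈1) (*-identityʳ ε)))

      within : ∀ {n} (P : TaggedPartition n) → (∀ i → width P i < δ) → Within ε (riemannSum f P) I
      within P w<δ = ≤-<-trans (≤-intro (proj₁ bounded) (solve 3 (λ s i b → s :- i :+ (b :+ (i :- s)) := b) refl _ _ _)) Kδ<ε
                   , ≤-<-trans (≤-intro (proj₂ bounded) (solve 3 (λ s i b → i :- s :+ (b :- (i :- s)) := b) refl _ _ _)) Kδ<ε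
        where
        open TaggedPartition P using (point; tag; first; last; point≤tag; tag≤point)
        bounded : Bounded (K * δ) (I - riemannSum f P)
        bounded = Bounded-cong
          (trans (*-congˡ (+-cong last (-‿cong first))) (trans (*-congˡ (x-0≈x 1#)) (*-identityʳ _)))
          (+-congʳ (trans (+-cong (F-cong last) (-‿cong (F-cong first))) total))
          (riemann-error point tag point≤tag tag≤point (≤-reflexive (sym first)) (≤-reflexive last) w<δ)

    -- Positivity of the integral and the Cauchy-Schwarz inequality.

    module _ (f-nonneg : ∀ x → 0# ≤ f x) where

      private
        -- On a cell of the uniform mesh of width r = 1/(1+n), `F` grows by at least f(x) r - K r² ≥
        -- - K r²; the first `i` cells are summed.
        mesh-bound : ∀ n i → i ℕ.≤ suc n →
          0# ≤ F (fromNat i * 1/1+ n) - F 0# + fromNat i * (K * (1/1+ n * 1/1+ n))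
        mesh-bound n zero _ = ≤-respʳ-≈ (sym (trans
          (+-cong (+-congʳ (F-cong (zeroˡ _))) refl)
          (solve 2 (λ x y → (x :- x) :+ :0 :* y := :0) refl (F 0#) _))) ≤-refl
        mesh-bound n (suc i) i<1+n = ≤-respʳ-≈
          (solve 6 (λ x y z k h c → (y :- x :+ c :* k) :+ ((k :+ (z :- y :- h)) :+ h) := z :- x :+ (:1 :+ c) :* k)
            refl (F 0#) (F x) (F y) (K * (r * r)) (f x * (y - x)) (fromNat i))
          (+-nonneg (mesh-bound n i (ℕ.<⇒≤ i<1+n))
            (+-nonneg (≤-respʳ-≈ (+-congʳ (*-congˡ (*-cong y-x≈r y-x≈r)))
                (proj₁ (bound {x} {x} {y} (*-nonneg (fromNat-nonneg i) 0≤r) ≤-refl x≤y y≤1)))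
              (*-nonneg (f-nonneg x) (x≤y⇒0≤y-x x≤y))))
          where
          r = 1/1+ n
          0≤r = <⇒≤ (1/1+-pos n)
          x = fromNat i * r
          y = fromNat (suc i) * r
          y-x≈r : y - x ≈ r
          y-x≈r = solve 2 (λ c r → (:1 :+ c) :* r :- c :* r := r) refl (fromNat i) r
          x≤y = ≤-intro 0≤r (solve 2 (λ c r → c :* r :+ r := (:1 :+ c) :* r) refl (fromNat i) r)
          y≤1 : y ≤ 1#
          y≤1 = ≤-respʳ-≈ (1/1+-inverse n)
            (≤-intro (*-nonneg 0≤r (x≤y⇒0≤y-x (fromNat-mono i<1+n)))
              (solve 3 (λ c d r → c :* r :+ r :* (d :- c) := d :* r) refl (fromNat (suc i)) (fromNat (suc n)) r))

        [1+n]I+K-nonneg : ∀ n → 0# ≤ fromNat (suc n) * I + K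
        [1+n]I+K-nonneg n = ≤-respʳ-≈
          (trans (solve 6 (λ x y c k r i → c :* (y :- x :+ c :* (k :* (r :* r)))
                    := c :* (y :- x) :+ (c :* r) :* (c :* r) :* k) refl (F 0#) (F (c * r)) c K r I)
            (+-cong (*-congˡ (trans (+-congʳ (F-cong cr≈1)) total))
              (trans (*-congʳ (trans (*-cong cr≈1 cr≈1) (*-identityʳ 1#))) (*-identityˡ K))))
          (*-nonneg (fromNat-nonneg (suc n)) (mesh-bound n (suc n) ℕ.≤-refl))
          where
          c = fromNat (suc n)
          r = 1/1+ n
          cr≈1 = 1/1+-inverse n

      -- A negative `I` contradicts `[1+n]I+K-nonneg` as soon as n exceeds K/(-I).
      integral-nonneg : 0# ≤ I
      integral-nonneg I<0 with reciprocal (-‿pos I<0)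
      ... | y , -Iy≈1 with archimedean (K * y)
      ... | n , Ky<n = [1+n]I+K-nonneg n (<-intro (+-pos (-‿pos I<0) (*-pos (-‿pos I<0) (x<y⇒0<y-x Ky<n)))
        (trans (solve 4 (λ c i k y → (:1 :+ c) :* i :+ k :+ (:- i :+ :- i :* (c :- k :* y))
                    := k :- k :* (:- i :* y)) refl (fromNat n) I K y)
          (trans (+-congˡ (-‿cong (trans (*-congˡ -Iy≈1) (*-identityʳ K)))) (-‿inverseʳ K))))

  -- The square (D f - B g)² has integral D (A D - B²), which is nonnegative, and `D` is positive.
  cauchySchwarz : ∀ {f g : Carrier → Carrier} {A B D} → Primitive (λ x → f x * f x) A → Primitive (λ x → f x * g x) B →
                  Primitive (λ x → g x * g x) D → 0# < D → B * B ≤ A * D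
  cauchySchwarz {f} {g} {A} {B} {D} ff fg gg 0<D = ≤-intro
    (*-cancelˡ-nonneg 0<D (integral-nonneg square λ x → sq-nonneg (D * f x - B * g x)))
    (solve 2 (λ u v → u :+ (v :- u) := v) refl (B * B) (A * D))
    where
    square : Primitive (λ x → (D * f x - B * g x) * (D * f x - B * g x)) (D * (A * D - B * B))
    square = Primitive-cong
      (λ x → solve 4 (λ d b f g → (d :* d :* (f :* f) :+ :- (d :* b :+ d :* b) :* (f :* g)) :+ b :* b :* (g :* g)
               := (d :* f :- b :* g) :* (d :* f :- b :* g)) refl D B (f x) (g x))
      (solve 3 (λ a b d → (d :* d :* a :+ :- (d :* b :+ d :* b) :* b) :+ b :* b :* d := d :* (a :* d :- b :* b)) refl A B D)
      (Primitive-+ (Primitive-+ (Primitive-* (D * D) ff) (Primitive-* (- (D * B + D * B)) fg)) (Primitive-* (B * B) gg))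

  -- Inner products and norms of polynomials from their coefficients.

  polynomial : (ℕ → Carrier) → ℕ → Carrier → Carrier
  polynomial u zero    x = u 0 * x ^ 0
  polynomial u (suc n) x = polynomial u n x + u (suc n) * x ^ suc n

  -- The inner product of the polynomial with x^m.
  moment : (ℕ → Carrier) → ℕ → ℕ → Carrier
  moment u zero    m = u 0 * 1/1+ m
  moment u (suc n) m = moment u n m + u (suc n) * 1/1+ (suc n ℕ.+ m)

  -- The squared norm, expanded one leading term at a time. `energyWith` leaves the leading
  -- coefficient free, for use in the minimisation.
  energy     : (ℕ → Carrier) → ℕ → Carrier
  energyWith : (ℕ → Carrier) → ℕ → Carrier → Carrier
  energy u zero    = u 0 * u 0 * 1/1+ 0
  energy u (suc n) = energyWith u n (u (suc n))
  energyWith u n v = energy u n + (v + v) * moment u n (suc n) + v * v * 1/1+ (suc n ℕ.+ suc n)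

  Primitive-^* : ∀ m n → Primitive (λ x → x ^ m * x ^ n) (1/1+ (m ℕ.+ n))
  Primitive-^* m n = Primitive-cong (λ x → ^-homo-* x m n) refl (Primitive-^ (m ℕ.+ n))

  Primitive-moment : ∀ u n m → Primitive (λ x → polynomial u n x * x ^ m) (moment u n m)
  Primitive-moment u zero    m = Primitive-cong (λ x → sym (*-assoc _ _ _)) refl (Primitive-* (u 0) (Primitive-^* 0 m))
  Primitive-moment u (suc n) m = Primitive-cong
    (λ x → trans (+-congˡ (sym (*-assoc _ _ _))) (sym (distribʳ _ _ _))) refl
    (Primitive-+ (Primitive-moment u n m) (Primitive-* (u (suc n)) (Primitive-^* (suc n) m)))

  Primitive-energy : ∀ u n → Primitive (λ x → polynomial u n x * polynomial u n x) (energy u n)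
  Primitive-energyWith : ∀ u n v → let p = λ x → polynomial u n x + v * x ^ suc n in
                         Primitive (λ x → p x * p x) (energyWith u n v)

  Primitive-energy u zero = Primitive-cong
    (λ x → solve 2 (λ u p → u :* u :* (p :* p) := (u :* p) :* (u :* p)) refl (u 0) (x ^ 0)) refl
    (Primitive-* (u 0 * u 0) (Primitive-^* 0 0))
  Primitive-energy u (suc n) = Primitive-energyWith u n (u (suc n))

  Primitive-energyWith u n v = Primitive-cong
    (λ x → solve 3 (λ p v q → (p :* p :+ (v :+ v) :* (p :* q)) :+ v :* v :* (q :* q) := (p :+ v :* q) :* (p :+ v :* q))
             refl (polynomial u n x) v (x ^ suc n)) refl
    (Primitive-+ (Primitive-+ (Primitive-energy u n) (Primitive-* (v + v) (Primitive-moment u n (suc n))))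
      (Primitive-* (v * v) (Primitive-^* (suc n) (suc n))))

-- From minimality to orthogonality.

module Orthogonality {a ℓ₁ ℓ₂} (ℝ : RealNumbers a ℓ₁ ℓ₂) where
  open Integration ℝ public

  -- With g = M + x r, half the derivative at `x`, the quadratic at `x` exceeds its value at the
  -- vertex by s g²; minimality forces g² ≤ 0.
  minimum⇒critical : ∀ {A M r s} x → 0# < s → s * r ≈ 1# →
    (∀ y → A + (x + x) * M + x * x * r ≤ A + (y + y) * M + y * y * r) → M + x * r ≈ 0#
  minimum⇒critical {A} {M} {r} {s} x 0<s sr≈1 minimal = sq≤0⇒≈0 (≤-intro
    (*-cancelˡ-nonneg 0<s (≤-respʳ-≈
      (combine {k = - (s * (g * g))} sr≈1
        (solve 5 (λ A M r s x → let g = M :+ x :* r; y = x :- g :* s in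
            (A :+ (y :+ y) :* M :+ y :* y :* r) :- (A :+ (x :+ x) :* M :+ x :* x :* r)
              :+ :- (s :* (g :* g)) :* (s :* r)
            := s :* :- (g :* g) :+ :- (s :* (g :* g)) :* :1) refl A M r s x))
      -- The test point is the vertex -M/r, because s r = 1.
      (x≤y⇒0≤y-x (minimal (x - g * s)))))
    (-‿inverseʳ (g * g)))
    where g = M + x * r

  ∣z∣²≈ : ∀ z → ∣ z ∣ ^ 2 ≈ re z * re z + im z * im z
  ∣z∣²≈ z = trans (*-congˡ (*-identityʳ _)) (trans (√-square (≤-respʳ-≈ (sym squares) nonneg)) squares)
    where
    squares : re z ^ 2 + im z ^ 2 ≈ re z * re z + im z * im z
    squares = +-cong (*-congˡ (*-identityʳ _)) (*-congˡ (*-identityʳ _))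
    nonneg = +-nonneg (sq-nonneg (re z)) (sq-nonneg (im z))

  module _ (c : ℕ → ℂ) where

    re-partialSum : ∀ n x → polynomial (re ∘ c) n x ≈ re (partialSum c n x)
    re-partialSum zero    x = refl
    re-partialSum (suc n) x = +-congʳ (re-partialSum n x)

    im-partialSum : ∀ n x → polynomial (im ∘ c) n x ≈ im (partialSum c n x)
    im-partialSum zero    x = refl
    im-partialSum (suc n) x = +-congʳ (im-partialSum n x)

    squaredNorm : ℕ → ℂ → Carrier
    squaredNorm n d = energyWith (re ∘ c) n (re d) + energyWith (im ∘ c) n (im d)

    squaredNorm-nonneg : ∀ n d → 0# ≤ squaredNorm n d
    squaredNorm-nonneg n d = +-nonneg
      (integral-nonneg (Primitive-energyWith (re ∘ c) n (re d)) λ x → sq-nonneg _)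
      (integral-nonneg (Primitive-energyWith (im ∘ c) n (im d)) λ x → sq-nonneg _)

    extend-norm : ∀ n d → HasNorm (extend c n d) (√ squaredNorm n d)
    extend-norm n d = squaredNorm n d , Primitive⇒HasIntegral
      (Primitive-cong
        (λ x → trans
          (+-cong (*-cong (+-congʳ (re-partialSum n x)) (+-congʳ (re-partialSum n x)))
                  (*-cong (+-congʳ (im-partialSum n x)) (+-congʳ (im-partialSum n x))))
          (sym (∣z∣²≈ (extend c n d x))))
        refl
        (Primitive-+ (Primitive-energyWith (re ∘ c) n (re d)) (Primitive-energyWith (im ∘ c) n (im d)))) , refl

    module _ (greedy : IsGreedy c) where

      open IsGreedy greedy

      squaredNorm-minimal : ∀ n d → squaredNorm n (c (suc n)) ≤ squaredNorm n d
      squaredNorm-minimal n d = √-cancel-≤ (squaredNorm-nonneg n (c (suc n))) (squaredNorm-nonneg n d)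
        (minimal n d (extend-norm n (c (suc n))) (extend-norm n d))

      -- Only the real part of the competitor varies, so the imaginary contribution cancels and a
      -- real quadratic remains. Its critical equation unfolds to the vanishing of the moment.
      re-orthogonal : ∀ n → moment (re ∘ c) (suc n) (suc n) ≈ 0#
      re-orthogonal n = minimum⇒critical (re (c (suc n))) (fromNat-pos (suc n ℕ.+ suc n)) (1/1+-inverse (suc n ℕ.+ suc n))
        λ y → ≤-intro (x≤y⇒0≤y-x (squaredNorm-minimal n (y +i im (c (suc n)))))
          (solve 3 (λ p q r → p :+ ((q :+ r) :- (p :+ r)) := q) refl _ _ _)

      im-orthogonal : ∀ n → moment (im ∘ c) (suc n) (suc n) ≈ 0#
      im-orthogonal n = minimum⇒critical (im (c (suc n))) (fromNat-pos (suc n ℕ.+ suc n)) (1/1+-inverse (suc n ℕ.+ suc n))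
        λ y → ≤-intro (x≤y⇒0≤y-x (squaredNorm-minimal n (re (c (suc n)) +i y)))
          (solve 3 (λ p q r → p :+ ((r :+ q) :- (r :+ p)) := q) refl _ _ _)

-- Energy estimates for real coefficient sequences.

module Decay {a ℓ₁ ℓ₂} (ℝ : RealNumbers a ℓ₁ ℓ₂) where
  open Orthogonality ℝ public

  1/1+-inverse-+ : ∀ m n → (1# + (fromNat m + fromNat n)) * 1/1+ (m ℕ.+ n) ≈ 1#
  1/1+-inverse-+ m n = trans (*-congʳ (+-congˡ (sym (fromNat-+ m n)))) (1/1+-inverse (m ℕ.+ n))

  module _ (u : ℕ → Carrier) where

    -- The coefficients of x p′, for p with coefficients u.
    derivative : ℕ → Carrier
    derivative k = fromNat k * u k

    -- The values p n (1).
    partialSums : ℕ → Carrier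
    partialSums zero    = u 0
    partialSums (suc n) = partialSums n + u (suc n)

    -- Integration by parts; on coefficients it reads k/(k+m+1) = 1 - (m+1)/(k+m+1).
    moment-derivative : ∀ n m → moment derivative n m ≈ partialSums n - fromNat (suc m) * moment u n m
    moment-derivative zero m = combine {k = - u 0} (1/1+-inverse m)
      (solve 3 (λ u c r → :0 :* u :* r :+ :- u :* (c :* r) := u :- c :* (u :* r) :+ :- u :* :1) refl (u 0) (fromNat (suc m)) (1/1+ m))
    moment-derivative (suc n) m = trans (+-congʳ (moment-derivative n m))
      (combine {k = - u (suc n)} (1/1+-inverse-+ (suc n) m)
        (solve 6 (λ s u c d r M → s :- (:1 :+ c) :* M :+ d :* u :* r :+ :- u :* ((:1 :+ (d :+ c)) :* r)
                      := s :+ u :- (:1 :+ c) :* (M :+ u :* r) :+ :- u :* :1)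
          refl (partialSums n) (u (suc n)) (fromNat m) (fromNat (suc n)) (1/1+ (suc n ℕ.+ m)) (moment u n m)))

    E F : ℕ → Carrier
    E = energy derivative
    F n = E n - fromNat n * (partialSums n * partialSums n)

    module _ (orthogonal : ∀ n → moment u (suc n) (suc n) ≈ 0#) where

      private module At (k : ℕ) where

        -- Orthogonality begins at degree 1.
        n = suc k
        x = fromNat n
        v = u (suc n)
        S = partialSums n
        ρ₀ = 1/1+ (n ℕ.+ n)
        ρ₁ = 1/1+ (n ℕ.+ suc n)
        ρ₂ = 1/1+ (suc n ℕ.+ suc n)

        0≤x : 0# ≤ x
        0≤x = fromNat-nonneg n

        moment-n : moment derivative n n ≈ S
        moment-n = trans (moment-derivative n n)
          (trans (+-congˡ (-‿cong (trans (*-congˡ (orthogonal k)) (zeroʳ _)))) (x-0≈x S))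

        -- Orthogonality of p (1+n) to x^(1+n) gives ⟨ p n , x^(1+n) ⟩ = - v ρ₂.
        moment-1+n : moment derivative n (suc n) ≈ S + (1# + (1# + x)) * (v * ρ₂)
        moment-1+n = trans (moment-derivative n (suc n))
          (combine {k = 1# + (1# + x)} (orthogonal n)
            (solve 4 (λ s c m w → s :- c :* m :+ c :* (m :+ w) := s :+ c :* w :+ c :* :0) refl S (1# + (1# + x)) (moment u n (suc n)) (v * ρ₂)))

        -- The squared norm of x^n - x^(1+n), equal to 2/((2n+1)(2n+2)(2n+3)).
        gap = ρ₀ - (ρ₁ + ρ₁) + ρ₂

        W : Carrier
        W = (1# + (x + x)) * (1# + (x + (1# + x))) * (1# + ((1# + x) + (1# + x)))

        W-pos : 0# < W
        W-pos = *-pos (*-pos (pos 0≤x 0≤x) (pos 0≤x 0≤1+x)) (pos 0≤1+x 0≤1+x)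
          where
          0≤1+x = +-nonneg (<⇒≤ 0<1) 0≤x
          pos : ∀ {y z} → 0# ≤ y → 0# ≤ z → 0# < 1# + (y + z)
          pos 0≤y 0≤z = <-≤-trans 0<1 (≤-intro (+-nonneg 0≤y 0≤z) refl)

        W*gap≈2 : W * gap ≈ 1# + 1#
        W*gap≈2 = trans
          (solve 7 (λ x r₀ r₁ r₂ p q s → p :* q :* s :* (r₀ :- (r₁ :+ r₁) :+ r₂)
              := q :* s :* (p :* r₀) :- (p :* s :* (q :* r₁) :+ p :* s :* (q :* r₁)) :+ p :* q :* (s :* r₂))
            refl x ρ₀ ρ₁ ρ₂ (1# + (x + x)) (1# + (x + (1# + x))) (1# + ((1# + x) + (1# + x))))
          (trans (+-cong (+-cong (*-congˡ (1/1+-inverse-+ n n))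
                      (-‿cong (+-cong (*-congˡ (1/1+-inverse-+ n (suc n))) (*-congˡ (1/1+-inverse-+ n (suc n))))))
                    (*-congˡ (1/1+-inverse-+ (suc n) (suc n))))
            (solve 1 (λ x → let p = :1 :+ (x :+ x); q = :1 :+ (x :+ (:1 :+ x)); s = :1 :+ ((:1 :+ x) :+ (:1 :+ x)) in
                q :* s :* :1 :- (p :* s :* :1 :+ p :* s :* :1) :+ p :* q :* :1 := :1 :+ :1) refl x))

        Primitive-gap : Primitive (λ y → (y ^ n - y ^ suc n) * (y ^ n - y ^ suc n)) gap
        Primitive-gap = Primitive-cong
          (λ y → solve 2 (λ p q → p :* p :+ :- (:1 :+ :1) :* (p :* q) :+ q :* q := (p :- q) :* (p :- q)) refl (y ^ n) (y ^ suc n))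
          (solve 3 (λ p q r → p :+ :- (:1 :+ :1) :* q :+ r := p :- (q :+ q) :+ r) refl ρ₀ ρ₁ ρ₂)
          (Primitive-+ (Primitive-+ (Primitive-^* n n) (Primitive-* (- 2#) (Primitive-^* n (suc n))))
            (Primitive-^* (suc n) (suc n)))

        -- Testing against a difference of consecutive powers cancels `S` and isolates the
        -- coefficient `v`.
        Primitive-cross : Primitive (λ y → polynomial derivative n y * (y ^ n - y ^ suc n)) (- ((1# + (1# + x)) * (v * ρ₂)))
        Primitive-cross = Primitive-cong
          (λ y → solve 3 (λ f p q → f :* p :+ :- :1 :* (f :* q) := f :* (p :- q)) refl (polynomial derivative n y) (y ^ n) (y ^ suc n))
          (trans (+-cong moment-n (*-congˡ moment-1+n))
            (solve 2 (λ s t → s :+ :- :1 :* (s :+ t) := :- t) refl S ((1# + (1# + x)) * (v * ρ₂))))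
          (Primitive-+ (Primitive-moment derivative n n) (Primitive-* (- 1#) (Primitive-moment derivative n (suc n))))

        -- Cauchy-Schwarz against x^n - x^(1+n) yields `scaled`, that is (2n+1)(2n+2)(n+2)² v² ≤
        -- 2(2n+3) E n.
        coefficient-bound : (1# + x) ^ 3 * (v * v) ≤ E n
        coefficient-bound = *-cancelˡ-≤ {w = 2# * s} (*-pos (+-pos 0<1 0<1) s-pos)
          (≤-intro
            (+-nonneg
              -- The slack is 2(n+1) v² times (2n+1)(n+2)² - (2n+3)(n+1)² = 2n²+4n+1.
              (*-nonneg (*-nonneg (+-nonneg 0≤1 0≤1) (+-nonneg 0≤1 (+-nonneg (*-nonneg 0≤4 0≤x) (*-nonneg (+-nonneg 0≤1 0≤1) (*-nonneg 0≤x 0≤x)))))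
                (*-nonneg (+-nonneg 0≤1 0≤x) (sq-nonneg v)))
              (x≤y⇒0≤y-x scaled))
            (solve 3 (λ x v e → let s = :1 :+ ((:1 :+ x) :+ (:1 :+ x)); y = :1 :+ x; t = :1 :+ y in
                (:1 :+ :1) :* s :* ((y :* (y :* (y :* :1))) :* (v :* v))
                  :+ ((:1 :+ :1) :* (:1 :+ ((:1 :+ :1 :+ (:1 :+ :1)) :* x :+ (:1 :+ :1) :* (x :* x))) :* (y :* (v :* v))
                  :+ ((:1 :+ :1) :* s :* e :- (:1 :+ (x :+ x)) :* (:1 :+ (x :+ y)) :* (t :* t :* (v :* v))))
                := (:1 :+ :1) :* s :* e) refl x v (E n)))
          where
          s = 1# + ((1# + x) + (1# + x))
          t = 1# + (1# + x)
          0≤1 = <⇒≤ 0<1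
          0≤4 = +-nonneg (+-nonneg 0≤1 0≤1) (+-nonneg 0≤1 0≤1)
          s-pos = <-≤-trans 0<1 (≤-intro (+-nonneg (+-nonneg 0≤1 0≤x) (+-nonneg 0≤1 0≤x)) refl)
          gap-pos = *-cancelˡ-pos W-pos (<-respʳ-≈ (sym W*gap≈2) (+-pos 0<1 0<1))
          sρ₂≈1 = 1/1+-inverse-+ (suc n) (suc n)

          schwarz : W * s * (- (t * (v * ρ₂)) * - (t * (v * ρ₂))) ≤ W * s * (E n * gap)
          schwarz = *-monoʳ-≤ (<⇒≤ (*-pos W-pos s-pos))
            (cauchySchwarz (Primitive-energy derivative n) Primitive-cross Primitive-gap gap-pos)

          scaled : (1# + (x + x)) * (1# + (x + (1# + x))) * (t * t * (v * v)) ≤ 2# * s * E n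
          scaled = ≤-respˡ-≈
            (trans (solve 6 (λ p q s t v r → p :* q :* s :* s :* (:- (t :* (v :* r)) :* :- (t :* (v :* r)))
                        := p :* q :* (t :* t :* (v :* v)) :* (s :* r :* (s :* r)))
                      refl (1# + (x + x)) (1# + (x + (1# + x))) s t v ρ₂)
              (trans (*-congˡ (trans (*-cong sρ₂≈1 sρ₂≈1) (*-identityʳ 1#))) (*-identityʳ _)))
            (≤-respʳ-≈
              (trans (solve 4 (λ w s e g → w :* s :* (e :* g) := w :* g :* s :* e) refl W s (E n) gap)
                (*-congʳ (*-congʳ W*gap≈2)))
              schwarz)

        -- Cauchy-Schwarz against x^n gives (2n+1) S² ≤ E n, so the n S² removed in `F n` is at most
        -- the fraction n/(2n+1) of the energy.
        E≤F : (1# + x) * E n ≤ (1# + (x + x)) * F n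
        E≤F = ≤-intro (*-nonneg 0≤x (x≤y⇒0≤y-x scaled))
          (solve 3 (λ x e s → let p = :1 :+ (x :+ x) in
              (:1 :+ x) :* e :+ x :* (e :- p :* (s :* s)) := p :* (e :- x :* (s :* s))) refl x (E n) S)
          where
          p-pos : 0# < 1# + (x + x)
          p-pos = <-≤-trans 0<1 (≤-intro (+-nonneg 0≤x 0≤x) refl)
          scaled : (1# + (x + x)) * (S * S) ≤ E n
          scaled = ≤-respʳ-≈
            (trans (solve 3 (λ p e r → p :* (e :* r) := p :* r :* e) refl (1# + (x + x)) (E n) ρ₀)
              (trans (*-congʳ (1/1+-inverse-+ n n)) (*-identityˡ _)))
            (*-monoʳ-≤ (<⇒≤ p-pos) (≤-respˡ-≈ (*-cong moment-n moment-n)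
              (cauchySchwarz (Primitive-energy derivative n) (Primitive-moment derivative n n) (Primitive-^* n n) (1/1+-pos (n ℕ.+ n)))))

        -- The correction in `F` makes the mixed terms 2(n+1) S v cancel. Exactly, F (1+n) = F n -
        -- S² + (n+1)(n+2) v²/(2n+3), and S² is dropped.
        F-increment : (1# + ((1# + x) + (1# + x))) * F (suc n)
                      ≤ (1# + ((1# + x) + (1# + x))) * F n + (1# + x) * (1# + (1# + x)) * (v * v)
        F-increment = ≤-intro (*-nonneg (<⇒≤ s-pos) (sq-nonneg S))
          (trans (+-congʳ (*-congˡ (+-congʳ (+-congʳ (+-congˡ (*-congˡ moment-1+n))))))
          (combine {k = - ((1# + x) * (1# + x) * (v * v) + 2# * ((1# + x) * (1# + (1# + x)) * (v * v)))}
            (1/1+-inverse-+ (suc n) (suc n))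
            (solve 5 (λ x v e S r → let y = :1 :+ x; t = :1 :+ y; s = :1 :+ (y :+ y); d = y :* v
                                        k = :- (y :* y :* (v :* v) :+ (:1 :+ :1) :* (y :* t :* (v :* v))) in
                s :* (e :+ (d :+ d) :* (S :+ t :* (v :* r)) :+ d :* d :* r :- y :* ((S :+ v) :* (S :+ v))) :+ s :* (S :* S)
                  :+ k :* (s :* r)
                := s :* (e :- x :* (S :* S)) :+ y :* t :* (v :* v) :+ k :* :1) refl x v (E n) S ρ₂)))
          where
          s-pos : 0# < 1# + ((1# + x) + (1# + x))
          s-pos = <-≤-trans 0<1 (≤-intro (+-nonneg (+-nonneg (<⇒≤ 0<1) 0≤x) (+-nonneg (<⇒≤ 0<1) 0≤x)) refl)

        E-nonneg : 0# ≤ E n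
        E-nonneg = integral-nonneg (Primitive-energy derivative n) λ y → sq-nonneg _

        F-nonneg : 0# ≤ F n
        F-nonneg = *-cancelˡ-nonneg (<-≤-trans 0<1 (≤-intro (+-nonneg 0≤x 0≤x) refl))
          (≤-trans (*-nonneg (+-nonneg (<⇒≤ 0<1) 0≤x) E-nonneg) E≤F)

      -- The growth factor 1 + 1/m² is at most m²/((m-1)(m+1)), whose products telescope.
      F-decay : ∀ k → (1# + fromNat (suc k)) * F (suc k) ≤ (fromNat (suc k) + fromNat (suc k)) * F 1
      F-decay zero = ≤-reflexive
        (solve 1 (λ f → (:1 :+ (:1 :+ :0)) :* f := ((:1 :+ :0) :+ (:1 :+ :0)) :* f) refl (F 1))
      F-decay (suc k) = *-cancelˡ-≤ (*-pos s-pos (*-pos 0<m (*-pos 0<m 0<m))) (≤-intro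
        -- The first four summands weight `F-increment`, `coefficient-bound`, `E≤F` and the
        -- induction hypothesis so that intermediate terms cancel. The last two are slack, from
        -- m(2m+1) - (m+1)(2m-1) = 1 and m⁴ - (m²-1)(m²+1) = 1 with m = n+1.
        (+-nonneg (+-nonneg (+-nonneg (+-nonneg (+-nonneg
          (*-nonneg (*-nonneg (*-nonneg 0≤m (*-nonneg 0≤m 0≤m)) 0≤1+m) (x≤y⇒0≤y-x F-increment))
          (*-nonneg (*-nonneg 0≤m (*-nonneg 0≤1+m 0≤1+m)) (x≤y⇒0≤y-x coefficient-bound)))
          (*-nonneg (*-nonneg 0≤1+m 0≤1+m) (x≤y⇒0≤y-x E≤F)))
          (*-nonneg (*-nonneg 0≤1+m (*-nonneg (<⇒≤ s-pos) (+-nonneg (<⇒≤ 0<1) (*-nonneg 0≤m 0≤m)))) (x≤y⇒0≤y-x (F-decay k))))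
          (*-nonneg 0≤1+m F-nonneg))
          (*-nonneg (+-nonneg (<⇒≤ s-pos) (<⇒≤ s-pos)) F₁-nonneg))
        (solve 6 (λ x v e f f′ f₁ → let m = :1 :+ x; s = :1 :+ (m :+ m); l = :1 :+ m; p = :1 :+ (x :+ x) in
            s :* (m :* (m :* m)) :* (l :* f′)
            :+ (m :* (m :* m) :* l :* ((s :* f :+ m :* l :* (v :* v)) :- s :* f′)
             :+ m :* (l :* l) :* (e :- (m :* (m :* (m :* :1))) :* (v :* v))
             :+ l :* l :* (p :* f :- m :* e)
             :+ l :* (s :* (:1 :+ m :* m)) :* ((x :+ x) :* f₁ :- m :* f)
             :+ l :* f
             :+ (s :+ s) :* f₁)
            := s :* (m :* (m :* m)) :* ((m :+ m) :* f₁))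
          refl x v (E (suc k)) (F (suc k)) (F (suc (suc k))) (F 1)))
        where
        open At k
        F₁-nonneg = At.F-nonneg zero
        m = 1# + x
        0<m : 0# < m
        0<m = <-≤-trans 0<1 (≤-intro 0≤x refl)
        0≤m = <⇒≤ 0<m
        0≤1+m : 0# ≤ 1# + m
        0≤1+m = +-nonneg (<⇒≤ 0<1) 0≤m
        s-pos : 0# < 1# + (m + m)
        s-pos = <-≤-trans 0<1 (≤-intro (+-nonneg 0≤m 0≤m) refl)

      -- Initial values and the explicit constant.

      private
        -- Orthogonality at degree 1, u₀/2 + u₁/3 = 0, cleared of denominators.
        3u₀+2u₁≈0 : 3# * u 0 + 2# * u 1 ≈ 0#
        3u₀+2u₁≈0 = combine {k = 3# * u 0} (1/1+-inverse 1)
          (combine {k = 2# * u 1} (1/1+-inverse 2)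
            (combine {k = - (2# * 3#)} (orthogonal 0)
              (solve 4 (λ a b r₁ r₂ → let t = :1 :+ :1; s = :1 :+ (:1 :+ :1) in
                  s :* a :+ t :* b :+ (s :* a) :* ((:1 :+ (:1 :+ :0)) :* r₁)
                    :+ (t :* b) :* ((:1 :+ (:1 :+ (:1 :+ :0))) :* r₂)
                    :+ :- (t :* s) :* (a :* r₁ :+ b :* r₂)
                  := :0 :+ (s :* a) :* :1 :+ (t :* b) :* :1 :+ :- (t :* s) :* :0)
                refl (u 0) (u 1) (1/1+ 1) (1/1+ 2))))

        4u₁²≈9u₀² : 4# * (u 1 * u 1) ≈ 9# * (u 0 * u 0)
        4u₁²≈9u₀² = combine {k = 3# * u 0 - 2# * u 1} 3u₀+2u₁≈0
          (solve 2 (λ a b → let t = :1 :+ :1; s = :1 :+ t in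
              t :* t :* (b :* b) :+ (s :* a :- t :* b) :* (s :* a :+ t :* b)
                := s :* s :* (a :* a) :+ (s :* a :- t :* b) :* :0) refl (u 0) (u 1))

        -- Six times the difference of the sides is 2(3u₀ + 2u₁)².
        2F₁≤u₀² : 2# * F 1 ≤ u 0 * u 0
        2F₁≤u₀² = *-cancelˡ-≤ (*-pos 0<2 0<3) (≤-intro
          (*-nonneg (<⇒≤ 0<2) (sq-nonneg (3# * u 0 + 2# * u 1)))
          (combine {k = - (4# * (u 1 * u 1))} (1/1+-inverse 2)
            (solve 5 (λ a b r₀ r₁ r₂ → let t = :1 :+ :1; s = :1 :+ t; d₀ = :0 :* a; d₁ = (:1 :+ :0) :* b in
              t :* s :* (t :* (d₀ :* d₀ :* r₀ :+ (d₁ :+ d₁) :* (d₀ :* r₁) :+ d₁ :* d₁ :* r₂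
                               :- (:1 :+ :0) :* ((a :+ b) :* (a :+ b))))
              :+ t :* ((s :* a :+ t :* b) :* (s :* a :+ t :* b))
              :+ :- (t :* t :* (b :* b)) :* ((:1 :+ (:1 :+ (:1 :+ :0))) :* r₂)
              := t :* s :* (a :* a) :+ :- (t :* t :* (b :* b)) :* :1) refl (u 0) (u 1) (1/1+ 0) (1/1+ 1) (1/1+ 2))))

      -- At index 1, u₁² = (9/4) u₀². Later, (n+1)³ u(n+1)² ≤ E n ≤ 4 F 1 ≤ 2 u₀². The common
      -- constant 4 is a perfect square, whose root becomes the final constant 2.
      cubic-bound : ∀ n → fromNat (suc n) ^ 3 * (u (suc n) * u (suc n)) ≤ 4# * (u 0 * u 0)
      cubic-bound zero = *-cancelˡ-≤ (*-pos 0<2 0<2) (≤-intro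
        (*-nonneg 0≤7 (sq-nonneg (u 0)))
        (combine {k = - 1#} 4u₁²≈9u₀²
          (solve 2 (λ a b → let t = :1 :+ :1; s = :1 :+ t in
            t :* t :* ((:1 :+ :0) :* ((:1 :+ :0) :* ((:1 :+ :0) :* :1)) :* (b :* b)) :+ (t :* t :+ s) :* (a :* a)
              :+ :- :1 :* (t :* t :* (b :* b))
            := t :* t :* (t :* t :* (a :* a)) :+ :- :1 :* (s :* s :* (a :* a))) refl (u 0) (u 1))))
        where
        0≤7 : 0# ≤ 4# + 3#
        0≤7 = <⇒≤ (+-pos (*-pos 0<2 0<2) 0<3)
      cubic-bound (suc k) = ≤-trans coefficient-bound (*-cancelˡ-≤ (*-pos 0<m 0<m) (≤-intro
        (+-nonneg (+-nonneg (+-nonneg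
          (*-nonneg 0≤m (x≤y⇒0≤y-x E≤F))
          (*-nonneg (+-nonneg (<⇒≤ 0<1) (+-nonneg 0≤x 0≤x)) (x≤y⇒0≤y-x (F-decay k))))
          (*-nonneg (*-nonneg (<⇒≤ 0<2) (*-nonneg 0≤m 0≤m)) (+-nonneg (x≤y⇒0≤y-x 2F₁≤u₀²) (sq-nonneg (u 0)))))
          (*-nonneg (<⇒≤ 0<2) (*-nonneg (+-nonneg (<⇒≤ 0<1) (+-nonneg (<⇒≤ 0<1) (+-nonneg 0≤x (+-nonneg 0≤x 0≤x)))) (At.F-nonneg zero))))
        (solve 5 (λ x e f f₁ a → let m = :1 :+ x; p = :1 :+ (x :+ x); t = :1 :+ :1 in
            m :* m :* e :+ (m :* (p :* f :- m :* e) :+ p :* ((x :+ x) :* f₁ :- m :* f)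
              :+ t :* (m :* m) :* ((a :* a :- t :* f₁) :+ a :* a)
              :+ t :* ((:1 :+ (:1 :+ (x :+ (x :+ x)))) :* f₁))
            := m :* m :* (t :* t :* (a :* a))) refl x (E (suc k)) (F (suc k)) (F 1) (u 0))))
        where
        open At k
        0<m : 0# < 1# + x
        0<m = <-≤-trans 0<1 (≤-intro 0≤x refl)
        0≤m = <⇒≤ 0<m

  -- Return to complex coefficients.

  ∣z∣*√w-bound : ∀ {w b} z → 0# ≤ w → 0# ≤ b → w * (re z * re z + im z * im z) ≤ b * b → ∣ z ∣ * √ w ≤ b
  ∣z∣*√w-bound {w} z 0≤w 0≤b w∣z∣²≤b² = sq-cancel-≤ 0≤b (≤-respˡ-≈
    (trans (*-cong (sym (√-square 0≤w)) (sym (∣z∣²≈ z)))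
      (solve 2 (λ s v → s :* s :* (v :* (v :* :1)) := v :* s :* (v :* s)) refl (√ w) ∣ z ∣))
    w∣z∣²≤b²)

  *≤⇒≤/ : ∀ {x y b} (y#0 : y # 0#) → 0# < y → x * y ≤ b → x ≤ b /⟨ y , y#0 ⟩
  *≤⇒≤/ {x} {y} {b} y#0 0<y xy≤b = *-cancelˡ-≤ 0<y (≤-respˡ-≈ (*-comm x y) (≤-respʳ-≈
    (sym (trans (solve 3 (λ y b i → y :* (b :* i) := b :* ((y :- :0) :* i)) refl y b _)
      (trans (*-congˡ (proj₂ (proj₂ (#⇒invertible y#0)))) (*-identityʳ b)))) xy≤b))

  greedy-bound : ∀ c → IsGreedy c → ∀ n → .{{_ : NonZero n}} → ∣ c n ∣ ≤ 2# /⟨ n ^3/2 , ^3/2-#0 n ⟩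
  greedy-bound c greedy (suc n) = *≤⇒≤/ (^3/2-#0 (suc n)) (√-pos N³-pos)
    -- The bounds for the real and imaginary parts are added; since c 0 = 1, the right side is 4 =
    -- 2².
    (∣z∣*√w-bound (c (suc n)) (<⇒≤ N³-pos) (<⇒≤ 0<2) (≤-respʳ-≈ initial (≤-intro
      (+-nonneg (x≤y⇒0≤y-x (cubic-bound (re ∘ c) (re-orthogonal c greedy) n))
                (x≤y⇒0≤y-x (cubic-bound (im ∘ c) (im-orthogonal c greedy) n)))
      (solve 5 (λ w a b p q → w :* (a :+ b) :+ ((p :- w :* a) :+ (q :- w :* b)) := p :+ q) refl _ _ _ _ _))))
    where
    N³-pos = ^-pos 3 (fromNat-pos n)
    re≈1 = proj₁ (IsGreedy.start greedy)
    im≈0 = proj₂ (IsGreedy.start greedy)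
    initial : 4# * (re (c 0) * re (c 0)) + 4# * (im (c 0) * im (c 0)) ≈ 4#
    initial = trans (+-cong (*-congˡ (*-cong re≈1 re≈1)) (*-congˡ (*-cong im≈0 im≈0)))
      (solve 1 (λ f → f :* (:1 :* :1) :+ f :* (:0 :* :0) := f) refl 4#)

theorem1 : ∀ {a ℓ₁ ℓ₂} (ℝ : RealNumbers a ℓ₁ ℓ₂) → let open GreedyCoefficients ℝ in
    (c : ℕ → ℂ) → IsGreedy c →
    ∃[ C ] (0# < C × (∀ n → .{{_ : NonZero n}} → ∣ c n ∣ ≤ C /⟨ n ^3/2 , ^3/2-#0 n ⟩))
theorem1 ℝ c greedy = 2# , 0<2 , greedy-bound c greedy
  where open Decay ℝ
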